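{- For every total Boolean function $f$, $\mathsf{CG}^{\mathrm{pub}}(f)\leq O(\mathsf{C}(f))$; that is, there is an absolute constant $K>0$ such that $\mathsf{CG}^{\mathrm{pub}}(f)\le K\cdot\mathsf{C}(f)$ for every $n$ and every $f:\{0,1\}^n\to\{0,1\}$.
   Context: $[n]=\{1,\dots,n\}$. Public coin certificate game complexity: one player receives $x\in f^{ -1}(0)$, the other $y\in f^{ -1}(1)$; without communication they must output a common index $i$ with $x_i\ne y_i$. A deterministic strategy is a pair $(A,B)$ with $A:f^{ -1}(0)\to[n]$, $B:f^{ -1}(1)\to[n]$; it is correct on $(x,y)$ if $A(x)=B(y)=i$ with $x_i\ne y_i$. Then $\mathsf{CG}^{\mathrm{pub}}(f)=\min_{p}\max_{x\in f^{ -1}(0),y\in f^{ -1}(1)}\Big(\sum_{(A,B)\text{ correct on }(x,y)}p_{A,B}\Big)^{ -1}$, with $p$ ranging over probability distributions on pairs $(A,B)$ of deterministic strategies. Certificate complexity: a certificate for $x$ is a partial assignment of input bits, consistent with $x$, that forces the value of $f$ to be constant regardless of the other bits. $\mathsf C(f;x)$ is the least number of assigned bits in a certificate for $x$; $\mathsf C^b(f)=\max_{x\in f^{ -1}(b)}\mathsf C(f;x)$ for $b\in\{0,1\}$; $\mathsf C(f)=\max\{\mathsf C^0(f),\mathsf C^1(f)\}$. Conventions: $1/0=+\infty$; a maximum over an empty set (constant $f$) is $0$. -}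

module Defs where

open import Data.Bool.Base using (Bool; true; false)
import Data.Bool.Properties as Bool
open import Data.Fin.Base using (Fin)
import Data.Fin.Properties as Fin
open import Data.Integer.Base using (+_)
open import Data.List.Base
  using (List; []; _∷_; map; mapMaybe; filter; foldr; cartesianProduct; cartesianProductWith)
import Data.List.Extrema
import Data.List.Extrema.Nat as ℕ-Extrema
open import Data.List.Membership.Propositional using (_∈_)
open import Data.List.Membership.Propositional.Properties using (∈-cartesianProductWith⁺)
open import Data.List.Relation.Unary.All as All using (All)
open import Data.List.Relation.Unary.Any using (here; there)
open import Data.Maybe.Base as Maybe using (Maybe; just; nothing)
import Data.Maybe.Relation.Unary.All as MaybeAll
open import Data.Nat.Base using (ℕ; zero; suc; _⊔_)
open import Data.Product.Base using (Σ-syntax; ∃-syntax; _×_; _,_; proj₁; proj₂)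
open import Data.Rational.Base using (ℚ; 0ℚ; 1ℚ; _+_; _≤_; _/_; 1/_; ≢-nonZero)
import Data.Rational.Properties as ℚ
open import Data.Sum.Base using (_⊎_)
open import Data.Vec.Base using (Vec; []; _∷_; lookup)
open import Level using (0ℓ)
open import Relation.Binary.Bundles using (TotalOrder)
import Relation.Binary.Construct.Add.Supremum.NonStrict as Supremum
open import Relation.Binary.PropositionalEquality using (_≡_; _≢_; refl)
open import Relation.Nullary.Construct.Add.Supremum using (_⁺; [_]; ⊤⁺)
open import Relation.Nullary.Decidable
  using (Dec; yes; no; map′; ¬?; _×-dec_; _→-dec_; dec⇒maybe)

words : ∀ {A : Set} → List A → ∀ n → List (Vec A n)
words as zero    = [] ∷ []
words as (suc n) = cartesianProductWith _∷_ as (words as n)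

∈-words : ∀ {A : Set} {as : List A} → (∀ a → a ∈ as) →
          ∀ {n} (w : Vec A n) → w ∈ words as n
∈-words ∈as []      = here refl
∈-words ∈as (a ∷ w) = ∈-cartesianProductWith⁺ _∷_ (∈as a) (∈-words ∈as w)

bools : List Bool
bools = false ∷ true ∷ []

∈-bools : ∀ b → b ∈ bools
∈-bools false = here refl
∈-bools true  = there (here refl)

BoolFun : ℕ → Set
BoolFun n = Vec Bool n → Bool

Preimage : ∀ {n} → BoolFun n → Bool → Set
Preimage {n} f b = Σ[ x ∈ Vec Bool n ] f x ≡ b

preimage : ∀ {n} (f : BoolFun n) (b : Bool) → List (Preimage f b)
preimage {n} f b =
  mapMaybe (λ x → Maybe.map (x ,_) (dec⇒maybe (f x Bool.≟ b))) (words bools n)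

Constant : ∀ {n} → BoolFun n → Set
Constant f = ∀ x y → f x ≡ f y

------------------------------------------------------------------------
-- Certificate complexity

-- `nothing` marks an unassigned coordinate.
PartialAssignment : ℕ → Set
PartialAssignment n = Vec (Maybe Bool) n

partialAssignments : ∀ n → List (PartialAssignment n)
partialAssignments = words (nothing ∷ map just bools)

size : ∀ {n} → PartialAssignment n → ℕ
size []            = 0
size (nothing ∷ ρ) = size ρ
size (just _  ∷ ρ) = suc (size ρ)

Consistent : ∀ {n} → PartialAssignment n → Vec Bool n → Set
Consistent ρ x = ∀ i → MaybeAll.All (λ b → lookup x i ≡ b) (lookup ρ i)

Certificate : ∀ {n} → BoolFun n → Vec Bool n → PartialAssignment n → Set
Certificate f x ρ = Consistent ρ x × (∀ y → Consistent ρ y → f y ≡ f x)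

consistent? : ∀ {n} (ρ : PartialAssignment n) x → Dec (Consistent ρ x)
consistent? ρ x = Fin.all? λ i → MaybeAll.dec (λ b → lookup x i Bool.≟ b) (lookup ρ i)

certificate? : ∀ {n} (f : BoolFun n) x ρ → Dec (Certificate f x ρ)
certificate? {n} f x ρ = consistent? ρ x ×-dec
  map′ (λ all y → All.lookup all (∈-words ∈-bools y)) (λ forces → All.tabulate λ {y} _ → forces y)
       (All.all? (λ y → consistent? ρ y →-dec (f y Bool.≟ f x)) (words bools n))

-- The default value n never matters: assigning every bit of x is a certificate
-- of size n.
Cₓ : ∀ {n} → BoolFun n → Vec Bool n → ℕ
Cₓ {n} f x = ℕ-Extrema.min n (map size (filter (certificate? f x) (partialAssignments n)))

Cᵇ : ∀ {n} → Bool → BoolFun n → ℕ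
Cᵇ b f = ℕ-Extrema.max 0 (map (λ (x , _) → Cₓ f x) (preimage f b))

C : ∀ {n} → BoolFun n → ℕ
C f = Cᵇ false f ⊔ Cᵇ true f

------------------------------------------------------------------------
-- Nonnegative costs with +∞

open Supremum _≤_ public using (_≤⁺_)

ℚ⁺-totalOrder : TotalOrder 0ℓ 0ℓ 0ℓ
ℚ⁺-totalOrder = record { isTotalOrder = Supremum.≤⁺-isTotalOrder-≡ _≤_ ℚ.≤-isTotalOrder }

module ℚ⁺-Extrema = Data.List.Extrema ℚ⁺-totalOrder

reciprocal : ℚ → ℚ ⁺
reciprocal p with p ℚ.≟ 0ℚ
... | yes _  = ⊤⁺
... | no p≢0 = [ (1/ p) {{≢-nonZero p≢0}} ]

------------------------------------------------------------------------
-- Public-coin certificate games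

sumℚ : List ℚ → ℚ
sumℚ = foldr _+_ 0ℚ

-- A finitely supported distribution given as a list of weighted outcomes.  An
-- outcome may be listed repeatedly; its probability is then the total of its
-- weights.
record Distribution (A : Set) : Set where
  field
    support    : List (ℚ × A)
    nonneg     : All (λ (w , _) → 0ℚ ≤ w) support
    normalised : sumℚ (map proj₁ support) ≡ 1ℚ

probability : ∀ {A : Set} {P : A → Set} → Distribution A → (∀ a → Dec (P a)) → ℚ
probability p P? = sumℚ (map proj₁ (filter (λ (_ , a) → P? a) (Distribution.support p)))

StrategyPair : ∀ {n} → BoolFun n → Set
StrategyPair {n} f = (Preimage f false → Fin n) × (Preimage f true → Fin n)

Correct : ∀ {n} (f : BoolFun n) → Preimage f false → Preimage f true → StrategyPair f → Set
Correct f x y (A , B) = A x ≡ B y × lookup (proj₁ x) (A x) ≢ lookup (proj₁ y) (A x)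

correct? : ∀ {n} (f : BoolFun n) x y (s : StrategyPair f) → Dec (Correct f x y s)
correct? f x y (A , B) =
  (A x Fin.≟ B y) ×-dec ¬? (lookup (proj₁ x) (A x) Bool.≟ lookup (proj₁ y) (A x))

cost : ∀ {n} (f : BoolFun n) → Distribution (StrategyPair f) → ℚ ⁺
cost f p = ℚ⁺-Extrema.max [ 0ℚ ]
  (map (λ (x , y) → reciprocal (probability p (correct? f x y)))
       (cartesianProduct (preimage f false) (preimage f true)))

-- CGpub≤ f t says that the minimum of `cost f` over all distributions is at
-- most t.  Minimising the cost is a linear program with rational data, so the
-- minimum over real distributions is attained at a rational one.
-- The first alternative is the convention that a constant function has value 0.
-- For n ≥ 1 it is subsumed by the second; for n = 0 it is needed, since there a
-- player with an input has no index to output and no strategy pair exists.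
CGpub≤ : ∀ {n} → BoolFun n → ℚ → Set
CGpub≤ f t =
  (Constant f × 0ℚ ≤ t) ⊎
  (∃[ p ] cost f p ≤⁺ [ t ])

fromℕ : ℕ → ℚ
fromℕ k = + k / 1

{-# OPTIONS --safe #-}

-- Fix a minimum certificate for every input.  The public coins select each
-- index independently with probability p = 1 / (4 C(f)), and a player outputs
-- a selected index of their certificate.  The certificates of a 0-input and a
-- 1-input conflict at some index i, and together they have at most 2 C(f)
-- indices; with probability at least p (1 - 2 C(f) p) = 1 / (8 C(f)), i is the
-- only one of these that is selected, and then both players output i.
module Submission where

open import Defs
open import Data.Bool.Base using (Bool; true; false)
import Data.Bool.Properties as Bool
open import Data.Fin.Base using (Fin; zero; suc)
import Data.Fin.Properties as Fin
import Data.Integer.Base as ℤ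
import Data.Integer.Properties as ℤ
open import Data.List.Base using (List; []; _∷_; _++_; map; filter; cartesianProduct)
import Data.List.Extrema.Nat as ℕ-Extrema
import Data.List.Membership.Propositional.Properties as ∈
import Data.List.Properties as List
open import Data.List.Relation.Unary.All as All using (All; []; _∷_)
import Data.List.Relation.Unary.All.Properties as All
open import Data.List.Relation.Unary.Any as Any using ()
import Data.List.Relation.Unary.Any.Properties as Any
open import Data.Maybe.Base as Maybe using (Maybe; just; nothing; fromMaybe; _<∣>_)
import Data.Maybe.Relation.Unary.All as MaybeAll
open import Data.Maybe.Relation.Unary.Any as MaybeAny using ()
open import Data.Maybe using (Is-just)
open import Data.Nat.Base as ℕ using (ℕ; zero; suc)
import Data.Nat.Properties as ℕ
open import Data.Product.Base using (∃-syntax; _×_; _,_; proj₁; proj₂; map₁; map₂)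
open import Data.Rational.Base
  using (ℚ; 0ℚ; 1ℚ; ½; _<_; _≤_; _+_; _-_; _*_; -_; 1/_; Positive;
         toℚᵘ; nonNegative; positive; ≢-nonZero; *≤*)
import Data.Rational.Properties as ℚ
import Data.Rational.Unnormalised.Base as ℚᵘ
import Data.Rational.Unnormalised.Properties as ℚᵘ
open import Data.Rational.Solver using (module +-*-Solver)
open import Data.Sum.Base using (inj₁; inj₂)
open import Data.Unit.Base using (tt)
open import Data.Vec.Base as Vec using (Vec; []; _∷_; lookup; zipWith; _[_]≔_)
import Data.Vec.Properties as Vec
open import Function.Base using (_∘_; const; case_of_)
open import Relation.Binary.Construct.Add.Supremum.NonStrict _≤_ using () renaming ([_] to ≤[_])
open import Relation.Binary.PropositionalEquality
open import Relation.Nullary.Construct.Add.Supremum using ([_])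
open import Relation.Nullary.Decidable using (Dec; yes; no; does; _×-dec_; dec⇒maybe; from-yes)
open import Relation.Nullary.Negation using (¬_; contradiction)
open import Relation.Unary using (Decidable)

open +-*-Solver using (solve; _:=_; _:+_; _:*_; _:-_; con)
open Distribution

-- Arithmetic of rationals and of reciprocals.

toℚᵘ-fromℕ : ∀ n → toℚᵘ (fromℕ n) ℚᵘ.≃ ℚᵘ.mkℚᵘ (ℤ.+ n) 0
toℚᵘ-fromℕ n = ℚ.toℚᵘ-fromℚᵘ (ℚᵘ.mkℚᵘ (ℤ.+ n) 0)

fromℕ-homo-+ : ∀ m n → fromℕ (m ℕ.+ n) ≡ fromℕ m + fromℕ n
fromℕ-homo-+ m n = ℚ.toℚᵘ-injective (begin
  toℚᵘ (fromℕ (m ℕ.+ n))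
    ≈⟨ toℚᵘ-fromℕ (m ℕ.+ n) ⟩
  ℚᵘ.mkℚᵘ (ℤ.+ (m ℕ.+ n)) 0
    ≈⟨ ℚᵘ.*≡* (cong (ℤ._* ℤ.+ 1) (sym (cong₂ ℤ._+_ (ℤ.*-identityʳ (ℤ.+ m)) (ℤ.*-identityʳ (ℤ.+ n))))) ⟩
  ℚᵘ.mkℚᵘ (ℤ.+ m) 0 ℚᵘ.+ ℚᵘ.mkℚᵘ (ℤ.+ n) 0
    ≈⟨ ℚᵘ.+-cong (toℚᵘ-fromℕ m) (toℚᵘ-fromℕ n) ⟨
  toℚᵘ (fromℕ m) ℚᵘ.+ toℚᵘ (fromℕ n)
    ≈⟨ ℚ.toℚᵘ-homo-+ (fromℕ m) (fromℕ n) ⟨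
  toℚᵘ (fromℕ m + fromℕ n) ∎)
  where open ℚᵘ.≃-Reasoning

fromℕ-mono-≤ : ∀ {m n} → m ℕ.≤ n → fromℕ m ≤ fromℕ n
fromℕ-mono-≤ {m} {n} m≤n = ℚ.toℚᵘ-cancel-≤ (begin
  toℚᵘ (fromℕ m)     ≃⟨ toℚᵘ-fromℕ m ⟩
  ℚᵘ.mkℚᵘ (ℤ.+ m) 0  ≤⟨ ℚᵘ.*≤* (ℤ.*-monoʳ-≤-nonNeg (ℤ.+ 1) (ℤ.+≤+ m≤n)) ⟩
  ℚᵘ.mkℚᵘ (ℤ.+ n) 0  ≃⟨ toℚᵘ-fromℕ n ⟨
  toℚᵘ (fromℕ n)     ∎)
  where open ℚᵘ.≤-Reasoning

fromℕ-nonneg : ∀ n → 0ℚ ≤ fromℕ n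
fromℕ-nonneg n = fromℕ-mono-≤ {0} {n} ℕ.z≤n

*-nonneg : ∀ {p q} → 0ℚ ≤ p → 0ℚ ≤ q → 0ℚ ≤ p * q
*-nonneg {p} {q} 0≤p 0≤q = ℚ.nonNegative⁻¹ (p * q)
  {{ℚ.nonNeg*nonNeg⇒nonNeg p {{nonNegative 0≤p}} q {{nonNegative 0≤q}}}}

*-monoˡ : ∀ {r p q} → 0ℚ ≤ r → p ≤ q → r * p ≤ r * q
*-monoˡ {r} 0≤r = ℚ.*-monoˡ-≤-nonNeg r {{nonNegative 0≤r}}

*-monoʳ : ∀ {r p q} → 0ℚ ≤ r → p ≤ q → p * r ≤ q * r
*-monoʳ {r} 0≤r = ℚ.*-monoʳ-≤-nonNeg r {{nonNegative 0≤r}}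

≤-+ʳ : ∀ {p q} → 0ℚ ≤ q → p ≤ p + q
≤-+ʳ {p} {q} 0≤q = subst (_≤ p + q) (ℚ.+-identityʳ p) (ℚ.+-monoʳ-≤ p 0≤q)

0≤1-p : ∀ {p} → p ≤ 1ℚ → 0ℚ ≤ 1ℚ - p
0≤1-p {p} p≤1 = subst (_≤ 1ℚ - p) (ℚ.+-inverseʳ p) (ℚ.+-monoˡ-≤ (- p) p≤1)

-- If `r` were 0, the product would be 0 and could not reach 1, so the infinite value of
-- `reciprocal` is excluded; otherwise multiply by `1/ r`. A hypothesis on the product spares
-- callers a proof that `r` is nonzero.
reciprocal-≤ : ∀ {r t} → 0ℚ ≤ r → 1ℚ ≤ r * t → reciprocal r ≤⁺ [ t ]
reciprocal-≤ {r} {t} 0≤r 1≤rt with r ℚ.≟ 0ℚ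
... | yes refl = contradiction (subst (1ℚ ≤_) (ℚ.*-zeroˡ t) 1≤rt) λ { (*≤* (ℤ.+≤+ ())) }
... | no r≢0 = ≤[ (begin
  1/ r             ≡⟨ ℚ.*-identityʳ (1/ r) ⟨
  1/ r * 1ℚ        ≤⟨ ℚ.*-monoˡ-≤-nonNeg (1/ r) 1≤rt ⟩
  1/ r * (r * t)   ≡⟨ ℚ.*-assoc (1/ r) r t ⟨
  1/ r * r * t     ≡⟨ cong (_* t) (ℚ.*-inverseˡ r) ⟩
  1ℚ * t           ≡⟨ ℚ.*-identityˡ t ⟩
  t                ∎) ]
  where
  open ℚ.≤-Reasoning
  instance
    r-nonZero = ≢-nonZero r≢0
    r-pos = ℚ.nonNeg∧nonZero⇒pos r {{nonNegative 0≤r}}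
    1/r-pos = ℚ.1/pos⇒pos r
    1/r-nonNeg = ℚ.pos⇒nonNeg (1/ r)

-- Finite distributions

-- Reweighting and relabelling both map over the support, and this moves the filter of an event past
-- them.
filter-map : ∀ {A B : Set} {P : B → Set} (P? : Decidable P) (g : A → B) xs →
             filter P? (map g xs) ≡ map g (filter (P? ∘ g) xs)
filter-map P? g []       = refl
filter-map P? g (x ∷ xs) with does (P? (g x))
... | true  = cong (g x ∷_) (filter-map P? g xs)
... | false = filter-map P? g xs

module _ {A : Set} where

  mass : List (ℚ × A) → ℚ
  mass = sumℚ ∘ map proj₁

  mass-nonneg : ∀ {ws} → All (λ (w , _) → 0ℚ ≤ w) ws → 0ℚ ≤ mass ws
  mass-nonneg []            = ℚ.≤-refl
  mass-nonneg (0≤w ∷ 0≤ws) = ℚ.+-mono-≤ 0≤w (mass-nonneg 0≤ws)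

  mass-++ : ∀ vs ws → mass (vs ++ ws) ≡ mass vs + mass ws
  mass-++ []             ws = sym (ℚ.+-identityˡ (mass ws))
  mass-++ ((v , _) ∷ vs) ws = trans (cong (v +_) (mass-++ vs ws)) (sym (ℚ.+-assoc v (mass vs) (mass ws)))

  mass-scale : ∀ c ws → mass (map (map₁ (c *_)) ws) ≡ c * mass ws
  mass-scale c []             = sym (ℚ.*-zeroʳ c)
  mass-scale c ((w , _) ∷ ws) = trans (cong (c * w +_) (mass-scale c ws)) (sym (ℚ.*-distribˡ-+ c w (mass ws)))

  probability-nonneg : ∀ {P : A → Set} (d : Distribution A) (P? : ∀ a → Dec (P a)) →
                       0ℚ ≤ probability d P?
  probability-nonneg d P? = mass-nonneg (All.filter⁺ (P? ∘ proj₂) (nonneg d))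

  point : A → Distribution A
  point a = record
    { support    = (1ℚ , a) ∷ []
    ; nonneg     = from-yes (0ℚ ℚ.≤? 1ℚ) ∷ []
    ; normalised = refl
    }

  probability-point : ∀ {P : A → Set} (P? : ∀ a → Dec (P a)) {a} → P a →
                      probability (point a) P? ≡ 1ℚ
  probability-point P? {a} pa = cong mass (List.filter-accept (P? ∘ proj₂) {xs = []} pa)

  -- A convex combination. Plain concatenation suffices because a support may list an outcome
  -- repeatedly.
  mix : ∀ c → 0ℚ ≤ c → c ≤ 1ℚ → Distribution A → Distribution A → Distribution A
  mix c 0≤c c≤1 d e = record
    { support    = map (map₁ (c *_)) (support d) ++ map (map₁ ((1ℚ - c) *_)) (support e)
    ; nonneg     = All.++⁺ (All.map⁺ (All.map (*-nonneg 0≤c) (nonneg d)))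
                           (All.map⁺ (All.map (*-nonneg (0≤1-p c≤1)) (nonneg e)))
    ; normalised = begin
        mass (map (map₁ (c *_)) (support d) ++ map (map₁ ((1ℚ - c) *_)) (support e))
          ≡⟨ mass-++ (map (map₁ (c *_)) (support d)) _ ⟩
        mass (map (map₁ (c *_)) (support d)) + mass (map (map₁ ((1ℚ - c) *_)) (support e))
          ≡⟨ cong₂ _+_ (mass-scale c (support d)) (mass-scale (1ℚ - c) (support e)) ⟩
        c * mass (support d) + (1ℚ - c) * mass (support e)
          ≡⟨ cong₂ (λ u v → c * u + (1ℚ - c) * v) (normalised d) (normalised e) ⟩
        c * 1ℚ + (1ℚ - c) * 1ℚ
          ≡⟨ solve 1 (λ x → x :* con 1ℚ :+ (con 1ℚ :- x) :* con 1ℚ := con 1ℚ) refl c ⟩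
        1ℚ ∎
    }
    where open ≡-Reasoning

  probability-mix : ∀ {P : A → Set} c 0≤c c≤1 d e (P? : ∀ a → Dec (P a)) →
    probability (mix c 0≤c c≤1 d e) P? ≡ c * probability d P? + (1ℚ - c) * probability e P?
  probability-mix c 0≤c c≤1 d e P? = begin
    mass (filter Q? (map (map₁ (c *_)) (support d) ++ map (map₁ ((1ℚ - c) *_)) (support e)))
      ≡⟨ cong mass (List.filter-++ Q? (map (map₁ (c *_)) (support d)) _) ⟩
    mass (filter Q? (map (map₁ (c *_)) (support d)) ++ filter Q? (map (map₁ ((1ℚ - c) *_)) (support e)))
      ≡⟨ mass-++ (filter Q? (map (map₁ (c *_)) (support d))) _ ⟩
    mass (filter Q? (map (map₁ (c *_)) (support d))) + mass (filter Q? (map (map₁ ((1ℚ - c) *_)) (support e)))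
      ≡⟨ cong₂ _+_ (scaled c (support d)) (scaled (1ℚ - c) (support e)) ⟩
    c * probability d P? + (1ℚ - c) * probability e P? ∎
    where
    open ≡-Reasoning
    Q? = λ (wa : ℚ × A) → P? (proj₂ wa)
    scaled : ∀ k ws → mass (filter Q? (map (map₁ (k *_)) ws)) ≡ k * mass (filter Q? ws)
    scaled k ws = trans (cong mass (filter-map Q? (map₁ (k *_)) ws)) (mass-scale k (filter Q? ws))

module _ {A B : Set} (g : A → B) where

  mass-map : ∀ ws → mass (map (map₂ g) ws) ≡ mass ws
  mass-map []             = refl
  mass-map ((w , _) ∷ ws) = cong (w +_) (mass-map ws)

  push : Distribution A → Distribution B
  push d = record
    { support    = map (map₂ g) (support d)
    ; nonneg     = All.map⁺ (nonneg d)
    ; normalised = trans (mass-map (support d)) (normalised d)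
    }

  probability-push : ∀ {P : B → Set} d (P? : ∀ b → Dec (P b)) →
                     probability (push d) P? ≡ probability d (P? ∘ g)
  probability-push d P? =
    trans (cong mass (filter-map (P? ∘ proj₂) (map₂ g) (support d)))
          (mass-map (filter (P? ∘ g ∘ proj₂) (support d)))

-- Independent biased coins

-- From here on partial assignments also constrain the coins, with true meaning
-- that an index is selected.
forbid : ∀ {n} → PartialAssignment n → PartialAssignment n
forbid = Vec.map (Maybe.map (const false))

-- Encodes the event that `i` is selected and no other assigned index of `ρ` is; the remaining coins
-- stay free.
isolate : ∀ {n} → Fin n → PartialAssignment n → PartialAssignment n
isolate i ρ = forbid ρ [ i ]≔ just true

module Coins (p : ℚ) (0≤p : 0ℚ ≤ p) (p≤1 : p ≤ 1ℚ) where

  coins : ∀ n → Distribution (Vec Bool n)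
  coins zero    = point []
  coins (suc n) = mix p 0≤p p≤1 (push (true ∷_) (coins n)) (push (false ∷_) (coins n))

  coins-suc : ∀ {n} {P : Vec Bool (suc n) → Set} (P? : ∀ r → Dec (P r)) →
    probability (coins (suc n)) P? ≡
    p * probability (coins n) (P? ∘ (true ∷_)) + (1ℚ - p) * probability (coins n) (P? ∘ (false ∷_))
  coins-suc {n} P? = trans
    (probability-mix p 0≤p p≤1 (push (true ∷_) (coins n)) (push (false ∷_) (coins n)) P?)
    (cong₂ (λ u v → p * u + (1ℚ - p) * v)
           (probability-push (true ∷_) (coins n) P?) (probability-push (false ∷_) (coins n) P?))

  -- The probability, as a product over independent coins, that the coins are consistent with the
  -- constraint; a free coin contributes the factor 1.
  likelihood : ∀ {n} → PartialAssignment n → ℚ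
  likelihood []               = 1ℚ
  likelihood (nothing ∷ τ)    = likelihood τ
  likelihood (just true ∷ τ)  = p * likelihood τ
  likelihood (just false ∷ τ) = (1ℚ - p) * likelihood τ

  0≤q : 0ℚ ≤ 1ℚ - p
  0≤q = 0≤1-p p≤1

  likelihood-nonneg : ∀ {n} (τ : PartialAssignment n) → 0ℚ ≤ likelihood τ
  likelihood-nonneg []               = from-yes (0ℚ ℚ.≤? 1ℚ)
  likelihood-nonneg (nothing ∷ τ)    = likelihood-nonneg τ
  likelihood-nonneg (just true ∷ τ)  = *-nonneg 0≤p (likelihood-nonneg τ)
  likelihood-nonneg (just false ∷ τ) = *-nonneg 0≤q (likelihood-nonneg τ)

  -- Induction on the coins, conditioning on the first one. If it is free, both branches obey the
  -- bound and their weights add up to 1; if it is fixed, the other branch is dropped, being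
  -- nonnegative.
  likelihood≤probability : ∀ {n} {P : Vec Bool n → Set} (P? : ∀ r → Dec (P r)) τ →
    (∀ r → Consistent τ r → P r) → likelihood τ ≤ probability (coins n) P?
  likelihood≤probability P? [] imp = ℚ.≤-reflexive (sym (probability-point P? (imp [] λ ())))
  likelihood≤probability {suc n} P? (nothing ∷ τ) imp = begin
    likelihood τ
      ≡⟨ solve 2 (λ x l → l := x :* l :+ (con 1ℚ :- x) :* l) refl p (likelihood τ) ⟩
    p * likelihood τ + (1ℚ - p) * likelihood τ
      ≤⟨ ℚ.+-mono-≤
           (*-monoˡ 0≤p (likelihood≤probability (P? ∘ (true ∷_)) τ
             λ r c → imp _ λ { zero → MaybeAll.nothing ; (suc i) → c i }))
           (*-monoˡ 0≤q (likelihood≤probability (P? ∘ (false ∷_)) τ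
             λ r c → imp _ λ { zero → MaybeAll.nothing ; (suc i) → c i })) ⟩
    p * probability (coins n) (P? ∘ (true ∷_)) + (1ℚ - p) * probability (coins n) (P? ∘ (false ∷_))
      ≡⟨ coins-suc P? ⟨
    probability (coins (suc n)) P? ∎
    where open ℚ.≤-Reasoning
  likelihood≤probability {suc n} P? (just true ∷ τ) imp = begin
    p * likelihood τ
      ≤⟨ *-monoˡ 0≤p (likelihood≤probability (P? ∘ (true ∷_)) τ
           λ r c → imp _ λ { zero → MaybeAll.just refl ; (suc i) → c i }) ⟩
    p * probability (coins n) (P? ∘ (true ∷_))
      ≤⟨ ≤-+ʳ (*-nonneg 0≤q (probability-nonneg (coins n) (P? ∘ (false ∷_)))) ⟩
    p * probability (coins n) (P? ∘ (true ∷_)) + (1ℚ - p) * probability (coins n) (P? ∘ (false ∷_))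
      ≡⟨ coins-suc P? ⟨
    probability (coins (suc n)) P? ∎
    where open ℚ.≤-Reasoning
  likelihood≤probability {suc n} P? (just false ∷ τ) imp = begin
    (1ℚ - p) * likelihood τ
      ≤⟨ *-monoˡ 0≤q (likelihood≤probability (P? ∘ (false ∷_)) τ
           λ r c → imp _ λ { zero → MaybeAll.just refl ; (suc i) → c i }) ⟩
    (1ℚ - p) * probability (coins n) (P? ∘ (false ∷_))
      ≤⟨ ≤-+ʳ (*-nonneg 0≤p (probability-nonneg (coins n) (P? ∘ (true ∷_)))) ⟩
    (1ℚ - p) * probability (coins n) (P? ∘ (false ∷_)) + p * probability (coins n) (P? ∘ (true ∷_))
      ≡⟨ ℚ.+-comm ((1ℚ - p) * probability (coins n) (P? ∘ (false ∷_))) _ ⟩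
    p * probability (coins n) (P? ∘ (true ∷_)) + (1ℚ - p) * probability (coins n) (P? ∘ (false ∷_))
      ≡⟨ coins-suc P? ⟨
    probability (coins (suc n)) P? ∎
    where open ℚ.≤-Reasoning

  -- Bernoulli's inequality, since the right side is the power of `1ℚ - p` with exponent `size ρ`.
  bernoulli : ∀ {n} (ρ : PartialAssignment n) →
    1ℚ - p * fromℕ (size ρ) ≤ likelihood (forbid ρ)
  bernoulli []            = ℚ.≤-reflexive (solve 1 (λ x → con 1ℚ :- x :* con 0ℚ := con 1ℚ) refl p)
  bernoulli (nothing ∷ ρ) = bernoulli ρ
  bernoulli (just _ ∷ ρ)  = begin
    1ℚ - p * fromℕ (suc (size ρ))
      ≡⟨ cong (λ s → 1ℚ - p * s) (fromℕ-homo-+ 1 (size ρ)) ⟩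
    1ℚ - p * (1ℚ + fromℕ (size ρ))
      -- The added term is the quadratic surplus that completes the factorisation in the next step.
      ≤⟨ ≤-+ʳ (*-nonneg 0≤p (*-nonneg 0≤p (fromℕ-nonneg (size ρ)))) ⟩
    1ℚ - p * (1ℚ + fromℕ (size ρ)) + p * (p * fromℕ (size ρ))
      ≡⟨ solve 2 (λ x s → con 1ℚ :- x :* (con 1ℚ :+ s) :+ x :* (x :* s) :=
                          (con 1ℚ :- x) :* (con 1ℚ :- x :* s)) refl p (fromℕ (size ρ)) ⟩
    (1ℚ - p) * (1ℚ - p * fromℕ (size ρ))
      ≤⟨ *-monoˡ 0≤q (bernoulli ρ) ⟩
    (1ℚ - p) * likelihood (forbid ρ) ∎
    where open ℚ.≤-Reasoning

  q*≤ : ∀ {l} → 0ℚ ≤ l → (1ℚ - p) * l ≤ l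
  q*≤ {l} 0≤l = begin
    (1ℚ - p) * l          ≤⟨ ≤-+ʳ (*-nonneg 0≤p 0≤l) ⟩
    (1ℚ - p) * l + p * l  ≡⟨ solve 2 (λ x l → (con 1ℚ :- x) :* l :+ x :* l := l) refl p l ⟩
    l                     ∎
    where open ℚ.≤-Reasoning

  -- If `ρ` leaves `i` free, isolating inserts the factor `p` and both sides agree. If `ρ` assigns
  -- `i`, then `p` replaces a factor `1ℚ - p`, which is at most 1.
  likelihood-isolate : ∀ {n} (i : Fin n) ρ →
    p * likelihood (forbid ρ) ≤ likelihood (isolate i ρ)
  likelihood-isolate zero    (nothing ∷ ρ) = ℚ.≤-refl
  likelihood-isolate zero    (just _ ∷ ρ)  =
    *-monoˡ 0≤p (q*≤ (likelihood-nonneg (forbid ρ)))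
  likelihood-isolate (suc i) (nothing ∷ ρ) = likelihood-isolate i ρ
  likelihood-isolate (suc i) (just _ ∷ ρ)  = begin
    p * ((1ℚ - p) * l)  ≡⟨ solve 2 (λ x l → x :* ((con 1ℚ :- x) :* l) := (con 1ℚ :- x) :* (x :* l)) refl p l ⟩
    (1ℚ - p) * (p * l)  ≤⟨ *-monoˡ 0≤q (likelihood-isolate i ρ) ⟩
    (1ℚ - p) * likelihood (isolate i ρ) ∎
    where
    open ℚ.≤-Reasoning
    l = likelihood (forbid ρ)

  isolation-probability : ∀ {n} {P : Vec Bool n → Set} (P? : ∀ r → Dec (P r)) i ρ →
    (∀ r → Consistent (isolate i ρ) r → P r) →
    p * (1ℚ - p * fromℕ (size ρ)) ≤ probability (coins n) P?
  isolation-probability P? i ρ imp =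
    ℚ.≤-trans (*-monoˡ 0≤p (bernoulli ρ))
      (ℚ.≤-trans (likelihood-isolate i ρ) (likelihood≤probability P? (isolate i ρ) imp))

-- Certificates

-- The minimum `Cₓ f x` is either attained by an enumerated certificate or equal to its default `n`;
-- in the latter case the full assignment of `x` is a witness. This choice fixes the certificates
-- that the players use.
certificate : ∀ {n} (f : BoolFun n) x → ∃[ ρ ] Certificate f x ρ × size ρ ≡ Cₓ f x
certificate {n} f x
  with ℕ-Extrema.argmin-sel (λ m → m) n (map size (filter (certificate? f x) (partialAssignments n)))
... | inj₂ min∈ =
  let ρ , _ , min≡ , cert = ∈.∈-map∘filter⁻ size (certificate? f x) {f = size} {xs = partialAssignments n} min∈
  in ρ , cert , sym min≡
... | inj₁ min≡n =
  Vec.map just x , (full-consistent x , λ y c → cong f (full-unique x y c)) , trans (size-full x) (sym min≡n)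
  where
  full-consistent : ∀ {m} (x : Vec Bool m) → Consistent (Vec.map just x) x
  full-consistent (b ∷ x) zero    = MaybeAll.just refl
  full-consistent (b ∷ x) (suc i) = full-consistent x i
  full-unique : ∀ {m} (x y : Vec Bool m) → Consistent (Vec.map just x) y → y ≡ x
  full-unique []      []      c = refl
  full-unique (_ ∷ x) (_ ∷ y) c = cong₂ _∷_ (MaybeAll.drop-just (c zero)) (full-unique x y (c ∘ suc))
  size-full : ∀ {m} (x : Vec Bool m) → size (Vec.map just x) ≡ m
  size-full []      = refl
  size-full (_ ∷ x) = cong suc (size-full x)

Cₓ≤Cᵇ : ∀ {n} (f : BoolFun n) {b} x → f x ≡ b → Cₓ f x ℕ.≤ Cᵇ b f
Cₓ≤Cᵇ {n} f {b} x fx≡b = ℕ-Extrema.v≤max⁺ 0 (map (λ (x , _) → Cₓ f x) (preimage f b)) (inj₂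
  (Any.map⁺ (Any.mapMaybe⁺ toPreimage (words bools n)
    (Any.map⁺ (Any.map (λ { refl → listed }) (∈-words ∈-bools x))))))
  where
  toPreimage : Vec Bool n → Maybe (Preimage f b)
  toPreimage y = Maybe.map (y ,_) (dec⇒maybe (f y Bool.≟ b))
  -- Only values of `Cₓ` are compared: the enumerated entry for `x` carries the equality proof found
  -- by the decision procedure, not `fx≡b`.
  listed : MaybeAny.Any (λ (y , _) → Cₓ f x ℕ.≤ Cₓ f y) (toPreimage x)
  listed with f x Bool.≟ b
  ... | yes _   = MaybeAny.just ℕ.≤-refl
  ... | no fx≢b = contradiction fx≡b fx≢b

Cᵇ≤C : ∀ {n} (f : BoolFun n) b → Cᵇ b f ℕ.≤ C f
Cᵇ≤C f false = ℕ.m≤m⊔n (Cᵇ false f) (Cᵇ true f)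
Cᵇ≤C f true  = ℕ.m≤n⊔m (Cᵇ false f) (Cᵇ true f)

Cₓ≤C : ∀ {n} (f : BoolFun n) x → Cₓ f x ℕ.≤ C f
Cₓ≤C f x = ℕ.≤-trans (Cₓ≤Cᵇ f x refl) (Cᵇ≤C f (f x))

empty-consistent : ∀ {n} (ρ : PartialAssignment n) → size ρ ≡ 0 → ∀ y → Consistent ρ y
empty-consistent (nothing ∷ ρ) s≡0 (_ ∷ y) zero    = MaybeAll.nothing
empty-consistent (nothing ∷ ρ) s≡0 (_ ∷ y) (suc i) = empty-consistent ρ s≡0 y i

-- A minimum certificate then assigns no bit, so every input is consistent with it. This settles the
-- case in which `1 / (4 C(f))` is undefined.
C≡0⇒constant : ∀ {n} (f : BoolFun n) → C f ≡ 0 → Constant f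
C≡0⇒constant f C≡0 x y =
  let ρ , (_ , forces) , size≡ = certificate f x
      size≡0 = ℕ.n≤0⇒n≡0 (subst₂ ℕ._≤_ (sym size≡) C≡0 (Cₓ≤C f x))
  in sym (forces y (empty-consistent ρ size≡0 y))

-- Conflicts and unions of certificates.

Assigned : ∀ {n} → PartialAssignment n → Fin n → Set
Assigned ρ i = Is-just (lookup ρ i)

overwrite-consistent : ∀ {n} (ρ : PartialAssignment n) y → Consistent ρ (zipWith fromMaybe y ρ)
overwrite-consistent (nothing ∷ ρ) (_ ∷ y) zero    = MaybeAll.nothing
overwrite-consistent (just _ ∷ ρ)  (_ ∷ y) zero    = MaybeAll.just refl
overwrite-consistent (_ ∷ ρ)       (_ ∷ y) (suc i) = overwrite-consistent ρ y i

-- If the certificates did not conflict, y overwritten by ρ would be consistent with both.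
certificates-conflict : ∀ {n} (f : BoolFun n) {x y ρ σ} → Certificate f x ρ → Certificate f y σ → f x ≢ f y →
  ∃[ i ] Assigned ρ i × Assigned σ i × lookup x i ≢ lookup y i
certificates-conflict {n} f {x} {y} {ρ} {σ} (ρ∋x , ρ-forces) (σ∋y , σ-forces) fx≢fy =
  let i , ¬agree = Fin.¬∀⟶∃¬ n _ (λ i → MaybeAll.dec (λ b → lookup z i Bool.≟ b) (lookup σ i)) ¬σ∋z
  in i , conflict (ρ∋x i) (σ∋y i)
       (¬agree ∘ subst (λ b → MaybeAll.All (b ≡_) (lookup σ i)) (sym (Vec.lookup-zipWith fromMaybe i y ρ)))
  where
  z = zipWith fromMaybe y ρ
  ¬σ∋z : ¬ Consistent σ z
  ¬σ∋z σ∋z = fx≢fy (trans (sym (ρ-forces z (overwrite-consistent ρ y))) (σ-forces z σ∋z))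
  -- Read at one index, with `r` from `ρ` and `s` from `σ`. If `s` is free, `z` agrees with it
  -- trivially; if `r` is free, `z` copies `y`, which agrees with `s`. So both are assigned, and `z`
  -- has the bit of `x` there while `σ` has that of `y`.
  conflict : ∀ {r s : Maybe Bool} {a b : Bool} → MaybeAll.All (a ≡_) r → MaybeAll.All (b ≡_) s →
             ¬ MaybeAll.All (fromMaybe b r ≡_) s → Is-just r × Is-just s × a ≢ b
  conflict _                    MaybeAll.nothing     ¬agree = contradiction MaybeAll.nothing ¬agree
  conflict MaybeAll.nothing     s                    ¬agree = contradiction s ¬agree
  conflict (MaybeAll.just refl) (MaybeAll.just refl) ¬agree =
    MaybeAny.just tt , MaybeAny.just tt , ¬agree ∘ MaybeAll.just

-- Where both assign a bit the left one wins. The choice is harmless, as `forbid` and `isolate`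
-- depend only on which indices are assigned.
_∪_ : ∀ {n} → PartialAssignment n → PartialAssignment n → PartialAssignment n
_∪_ = zipWith _<∣>_

size-∪ : ∀ {n} (ρ σ : PartialAssignment n) → size (ρ ∪ σ) ℕ.≤ size ρ ℕ.+ size σ
size-∪ []            []            = ℕ.z≤n
size-∪ (nothing ∷ ρ) (nothing ∷ σ) = size-∪ ρ σ
size-∪ (nothing ∷ ρ) (just _ ∷ σ)  =
  subst (suc (size (ρ ∪ σ)) ℕ.≤_) (sym (ℕ.+-suc (size ρ) (size σ))) (ℕ.s≤s (size-∪ ρ σ))
size-∪ (just _ ∷ ρ)  (nothing ∷ σ) = ℕ.s≤s (size-∪ ρ σ)
size-∪ (just _ ∷ ρ)  (just _ ∷ σ)  =
  ℕ.s≤s (ℕ.≤-trans (size-∪ ρ σ) (ℕ.+-monoʳ-≤ (size ρ) (ℕ.n≤1+n (size σ))))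

∪-assignedˡ : ∀ {n} (ρ σ : PartialAssignment n) i → Assigned ρ i → Assigned (ρ ∪ σ) i
∪-assignedˡ (just _ ∷ ρ) (_ ∷ σ) zero    a = MaybeAny.just tt
∪-assignedˡ (_ ∷ ρ)      (_ ∷ σ) (suc i) a = ∪-assignedˡ ρ σ i a

∪-assignedʳ : ∀ {n} (ρ σ : PartialAssignment n) i → Assigned σ i → Assigned (ρ ∪ σ) i
∪-assignedʳ (nothing ∷ ρ) (_ ∷ σ) zero    a = a
∪-assignedʳ (just _ ∷ ρ)  (_ ∷ σ) zero    a = MaybeAny.just tt
∪-assignedʳ (_ ∷ ρ)       (_ ∷ σ) (suc i) a = ∪-assignedʳ ρ σ i a

-- The strategy

selected? : ∀ {n} (r : Vec Bool n) (ρ : PartialAssignment n) i → Dec (Assigned ρ i × lookup r i ≡ true)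
selected? r ρ i = MaybeAny.dec (λ _ → yes tt) (lookup ρ i) ×-dec (lookup r i Bool.≟ true)

-- The fallback `zero` is why the number of bits has the form `suc n`.
pick : ∀ {n} → Vec Bool (suc n) → PartialAssignment (suc n) → Fin (suc n)
pick r ρ with Fin.any? (selected? r ρ)
... | yes (i , _) = i
... | no _        = zero

isolate-self : ∀ {n} i (ρ : PartialAssignment n) r → Consistent (isolate i ρ) r → lookup r i ≡ true
isolate-self zero    (_ ∷ ρ) r       c with MaybeAll.just r≡true ← c zero = r≡true
isolate-self (suc i) (_ ∷ ρ) (_ ∷ r) c = isolate-self i ρ r (c ∘ suc)

avoids : ∀ {n} (ρ : PartialAssignment n) r → Consistent (forbid ρ) r →
         ∀ i → Assigned ρ i → lookup r i ≡ false
avoids (just _ ∷ ρ) r       c zero    _ with MaybeAll.just r≡false ← c zero = r≡false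
avoids (_ ∷ ρ)      (_ ∷ r) c (suc i) a = avoids ρ r (c ∘ suc) i a

-- At every assigned index other than `i` the constraint forces the coin to be `false`.
isolate-unique : ∀ {n} i (ρ : PartialAssignment n) r → Consistent (isolate i ρ) r →
                 ∀ j → Assigned ρ j → lookup r j ≡ true → j ≡ i
isolate-unique zero    (_ ∷ ρ)      r          c zero    a t = refl
isolate-unique zero    (_ ∷ ρ)      (_ ∷ r)    c (suc j) a t
  with () ← trans (sym t) (avoids ρ r (c ∘ suc) j a)
isolate-unique (suc i) (just _ ∷ ρ) (true ∷ r) c zero    a t with MaybeAll.just () ← c zero
isolate-unique (suc i) (_ ∷ ρ)      (_ ∷ r)    c (suc j) a t = cong suc (isolate-unique i ρ r (c ∘ suc) j a t)

-- Whatever index the search returns is assigned and selected, hence equal to `i`. Isolation is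
-- taken in a larger assignment `υ` so that one event serves both players, with `υ` the union of
-- their certificates.
pick-isolated : ∀ {n} i (ρ υ : PartialAssignment (suc n)) r → (∀ j → Assigned ρ j → Assigned υ j) →
                Assigned ρ i → Consistent (isolate i υ) r → pick r ρ ≡ i
pick-isolated i ρ υ r ρ⊆υ i∈ρ c with Fin.any? (selected? r ρ)
... | yes (j , j∈ρ , r∋j) = isolate-unique i υ r c j (ρ⊆υ j j∈ρ) r∋j
... | no ∄                = contradiction (i , i∈ρ , isolate-self i υ r c) ∄

-- Each outcome `r` of the public coins yields a deterministic pair, in which both players follow
-- the same rule.
strategy : ∀ {n} (f : BoolFun (suc n)) → Vec Bool (suc n) → StrategyPair f
strategy f r = play , play
  where
  play : ∀ {b} → Preimage f b → Fin _
  play (x , _) = pick r (proj₁ (certificate f x))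

preimages-conflict : ∀ {n} (f : BoolFun n) (x : Preimage f false) (y : Preimage f true) →
  let ρ = proj₁ (certificate f (proj₁ x)) ; σ = proj₁ (certificate f (proj₁ y)) in
  ∃[ i ] Assigned ρ i × Assigned σ i × lookup (proj₁ x) i ≢ lookup (proj₁ y) i
preimages-conflict f (x , fx≡false) (y , fy≡true) =
  certificates-conflict f {x} {y} {proj₁ (certificate f x)} {proj₁ (certificate f y)}
    (proj₁ (proj₂ (certificate f x))) (proj₁ (proj₂ (certificate f y)))
    λ fx≡fy → case trans (sym fx≡false) (trans fx≡fy fy≡true) of λ ()

-- Winning probability and cost.

module Game {n} (f : BoolFun (suc n)) (k : ℕ) (C≡ : C f ≡ suc k) where

  N : ℚ
  N = fromℕ (suc k)

  1≤N : 1ℚ ≤ N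
  1≤N = fromℕ-mono-≤ {1} {suc k} (ℕ.s≤s ℕ.z≤n)

  instance
    N-pos : Positive N
    N-pos = positive (ℚ.<-≤-trans (from-yes (0ℚ ℚ.<? 1ℚ)) 1≤N)
    N-nonZero = ℚ.pos⇒nonZero N
    1/N-pos = ℚ.1/pos⇒pos N

  p : ℚ
  p = ½ * ½ * 1/ N

  -- Two certificates together assign at most `N + N` indices, so this bounds the expected number of
  -- selected ones by one half.
  p*N : p * (N + N) ≡ ½
  p*N = begin
    ½ * ½ * 1/ N * (N + N)
      ≡⟨ solve 2 (λ y x → con ½ :* con ½ :* y :* (x :+ x) := con ½ :* (y :* x)) refl (1/ N) N ⟩
    ½ * (1/ N * N)
      ≡⟨ cong (½ *_) (ℚ.*-inverseˡ N) ⟩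
    ½ ∎
    where open ≡-Reasoning

  0≤p : 0ℚ ≤ p
  0≤p = *-nonneg {½ * ½} (from-yes (0ℚ ℚ.≤? ½ * ½)) (ℚ.<⇒≤ (ℚ.positive⁻¹ (1/ N)))

  p≤1 : p ≤ 1ℚ
  p≤1 = begin
    p              ≡⟨ ℚ.*-identityʳ p ⟨
    p * 1ℚ         ≤⟨ *-monoˡ 0≤p (ℚ.≤-trans 1≤N (≤-+ʳ (fromℕ-nonneg (suc k)))) ⟩
    p * (N + N)    ≡⟨ p*N ⟩
    ½              ≤⟨ from-yes (½ ℚ.≤? 1ℚ) ⟩
    1ℚ             ∎
    where open ℚ.≤-Reasoning

  open Coins p 0≤p p≤1

  play : Distribution (StrategyPair f)
  play = push (strategy f) (coins (suc n))

  winning-probability : ∀ x y → p * ½ ≤ probability play (correct? f x y)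
  winning-probability x y = begin
    p * ½
      ≤⟨ *-monoˡ 0≤p half ⟩
    p * (1ℚ - p * fromℕ (size (ρ ∪ σ)))
      ≤⟨ isolation-probability (correct? f x y ∘ strategy f) i (ρ ∪ σ) wins ⟩
    probability (coins (suc n)) (correct? f x y ∘ strategy f)
      ≡⟨ probability-push (strategy f) (coins (suc n)) (correct? f x y) ⟨
    probability play (correct? f x y) ∎
    where
    open ℚ.≤-Reasoning
    ρ = proj₁ (certificate f (proj₁ x))
    σ = proj₁ (certificate f (proj₁ y))
    conflict = preimages-conflict f x y
    i = proj₁ conflict

    size≤ : ∀ z → size (proj₁ (certificate f z)) ℕ.≤ suc k
    size≤ z = subst₂ ℕ._≤_ (sym (proj₂ (proj₂ (certificate f z)))) C≡ (Cₓ≤C f z)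

    half : ½ ≤ 1ℚ - p * fromℕ (size (ρ ∪ σ))
    half = ℚ.+-monoʳ-≤ 1ℚ (ℚ.neg-antimono-≤ (begin
      p * fromℕ (size (ρ ∪ σ))
        ≤⟨ *-monoˡ 0≤p (fromℕ-mono-≤ (ℕ.≤-trans (size-∪ ρ σ) (ℕ.+-mono-≤ (size≤ (proj₁ x)) (size≤ (proj₁ y))))) ⟩
      p * fromℕ (suc k ℕ.+ suc k)
        ≡⟨ cong (p *_) (fromℕ-homo-+ (suc k) (suc k)) ⟩
      p * (N + N)
        ≡⟨ p*N ⟩
      ½ ∎))

    wins : ∀ r → Consistent (isolate i (ρ ∪ σ)) r → Correct f x y (strategy f r)
    wins r c =
      let _ , i∈ρ , i∈σ , xᵢ≢yᵢ = conflict
          x↦i = pick-isolated i ρ (ρ ∪ σ) r (∪-assignedˡ ρ σ) i∈ρ c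
          y↦i = pick-isolated i σ (ρ ∪ σ) r (∪-assignedʳ ρ σ) i∈σ c
      in trans x↦i (sym y↦i) ,
         -- `Correct` reads both inputs at the output of the first player, so the conflict at `i` is
         -- transported to that index.
         subst (λ j → lookup (proj₁ x) j ≢ lookup (proj₁ y) j) (sym x↦i) xᵢ≢yᵢ

  p½*8N : p * ½ * (fromℕ 8 * N) ≡ 1ℚ
  p½*8N = begin
    ½ * ½ * 1/ N * ½ * (fromℕ 8 * N)
      ≡⟨ solve 2 (λ y x → con ½ :* con ½ :* y :* con ½ :* (con (fromℕ 8) :* x) := y :* x) refl (1/ N) N ⟩
    1/ N * N
      ≡⟨ ℚ.*-inverseˡ N ⟩
    1ℚ ∎
    where open ≡-Reasoning

  0≤8N : 0ℚ ≤ fromℕ 8 * N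
  0≤8N = *-nonneg (fromℕ-nonneg 8) (fromℕ-nonneg (suc k))

  cost-bound : cost f play ≤⁺ [ fromℕ 8 * N ]
  -- The maximum has the default `[ 0ℚ ]`, which needs its own bound `0≤8N`.
  cost-bound = ℚ⁺-Extrema.max≤v⁺ ≤[ 0≤8N ]
    (All.map⁺ {xs = cartesianProduct (preimage f false) (preimage f true)} (All.tabulate λ { {x , y} _ → reciprocal-≤
      (probability-nonneg play (correct? f x y))
      (subst (_≤ probability play (correct? f x y) * (fromℕ 8 * N)) p½*8N
        (*-monoʳ 0≤8N (winning-probability x y))) }))

-- Generalising `C f` to `c` allows a case split that supplies the successor `Game` asks for, making
-- `N` invertible. With `c` zero, or with no input bits, `f` is constant and the convention applies.
CGpub≤8C : ∀ {n} (f : BoolFun n) c → C f ≡ c → CGpub≤ f (fromℕ 8 * fromℕ c)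
CGpub≤8C         f zero    C≡ = inj₁ (C≡0⇒constant f C≡ , from-yes (0ℚ ℚ.≤? fromℕ 8 * fromℕ 0))
CGpub≤8C {zero}  f (suc k) C≡ = inj₁ ((λ { [] [] → refl }) , *-nonneg (fromℕ-nonneg 8) (fromℕ-nonneg (suc k)))
CGpub≤8C {suc n} f (suc k) C≡ = inj₂ (Game.play f k C≡ , Game.cost-bound f k C≡)

theorem5p4 : ∃[ K ] (0ℚ < K × (∀ (n : ℕ) (f : BoolFun n) → CGpub≤ f (K * fromℕ (C f))))
theorem5p4 = fromℕ 8 , from-yes (0ℚ ℚ.<? fromℕ 8) , λ n f → CGpub≤8C f (C f) refl
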